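{- Let $P$ be an extended logic program and let $J_{Dung}$ be the set of justified arguments of $P$ according to Dung's grounded argumentation semantics, i.e. the set of $a/u$-justified arguments. Then $J_{Dung}=J_{a/su}=J_{a/u}=J_{a/a}=J_{a/d}=J_{a/sa}$, and $J_{Dung}\subseteq J_{x/y}$ for all notions of attack $x$ and $y$.
   Context: Extended logic programs. An objective literal is an atom $B$ or its explicit negation $\neg B$; $\neg\neg L = L$. A default literal is $not~L$ with $L$ an objective literal. An extended logic program $P$ is a (possibly infinite) set of rules $L_0 \gets L_1,\dots,L_m, not~L_{m+1},\dots,not~L_{m+n}$ with $m,n\ge 0$ and all $L_i$ objective literals; $L_0$ is the head, the right-hand side is the body. Arguments. An argument for $P$ is a finite sequence $A=[r_1,\dots,r_n]$ of rules of $P$ such that for every $i$ and every objective literal $L$ in the body of $r_i$ there is $k>i$ with $head(r_k)=L$. A subargument of $A$ is a subsequence of $A$ that is an argument. Heads of rules of $A$ are its conclusions; default literals in bodies of rules of $A$ are its assumptions. $A$ is minimal for a conclusion $L$ if no proper subargument of $A$ has conclusion $L$; $A$ is minimal if it is minimal for some $L$. $\mathit{Args}_P$ is the set of minimal arguments for $P$; all arguments below range over $\mathit{Args}_P$. Notions of attack. A notion of attack is a function $x$ which assigns to each extended logic program $P$ a binary relation $x_P\subseteq \mathit{Args}_P^2$ (the subscript $P$ is omitted when clear). In particular: $A_1$ undercuts $A_2$ ($u$) if there is an objective literal $L$ that is a conclusion of $A_1$ with $not~L$ an assumption of $A_2$. $A_1$ rebuts $A_2$ ($r$) if there is an objective literal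 $L$ that is a conclusion of $A_1$ with $\neg L$ a conclusion of $A_2$. With $u^{ -1}$ the inverse relation of $u$: attacks $a=u\cup r$; defeats $d=u\cup(r-u^{ -1})$; strongly attacks $sa=(u\cup r)-u^{ -1}$; strongly undercuts $su=u-u^{ -1}$. Justified arguments. For notions of attack $x,y$ and $S\subseteq \mathit{Args}_P$, $A$ is $x/y$-acceptable wrt. $S$ if for every argument $B$ with $(B,A)\in x$ there is $C\in S$ with $(C,B)\in y$. $J_{x/y}$ is the least fixpoint of the monotone operator $S\mapsto\{A\mid A\text{ is }x/y\text{ -acceptable wrt. }S\}$ on subsets of $\mathit{Args}_P$; its elements are called $x/y$-justified. Dung's grounded argumentation semantics is by definition $a/u$-justifiability.
   Formalization: The inclusion J_Dung ⊆ J_{x/y} is false for arbitrary notions of attack (P = {p ←}, x full, y empty), so it is stated only for x contained in a and y containing su at P; equality of atoms is assumed decidable, which holds classically. -}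

module Defs where

open import Data.Fin as Fin using (Fin)
open import Data.List using (List; map; concatMap; length; lookup)
open import Data.List.Membership.Propositional using (_∈_; _∉_)
open import Data.List.Relation.Binary.Sublist.Propositional using () renaming (_⊆_ to _⊑_)
open import Data.List.Relation.Unary.All using (All)
open import Data.Product using (∃; ∃-syntax; _×_; _,_)
open import Data.Refinement using (Refinement-syntax; value)
open import Function using (flip)
open import Level using (Level; _⊔_; suc)
open import Relation.Binary using (Rel)
open import Relation.Binary.Construct.Union using (_∪_)
open import Relation.Binary.PropositionalEquality using (_≡_; _≢_)
open import Relation.Nullary using (¬_)
open import Relation.Unary using (Pred; _⊆_; _≐_)

private
  variable
    a p s ℓ ℓ₁ ℓ₂ : Level

infixl 6 _∖_

_∖_ : {X : Set a} → Rel X ℓ₁ → Rel X ℓ₂ → Rel X (ℓ₁ ⊔ ℓ₂)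
(R ∖ S) A B = R A B × ¬ S A B

data ObjectiveLiteral (Atom : Set a) : Set a where
  pos neg : Atom → ObjectiveLiteral Atom

∼_ : {Atom : Set a} → ObjectiveLiteral Atom → ObjectiveLiteral Atom
∼ pos B = neg B
∼ neg B = pos B

-- head ← L₁, …, Lₘ, not Lₘ₊₁, …, not Lₘ₊ₙ  with  objective = [L₁, …, Lₘ]
-- and  default = [Lₘ₊₁, …, Lₘ₊ₙ]: the default literal not L is represented by L.
record Rule (Atom : Set a) : Set a where
  field
    head      : ObjectiveLiteral Atom
    objective : List (ObjectiveLiteral Atom)
    default   : List (ObjectiveLiteral Atom)

open Rule public

Program : Set a → (p : Level) → Set (a ⊔ suc p)
Program Atom p = Pred (Rule Atom) p

module _ {Atom : Set a} where

  conclusions : List (Rule Atom) → List (ObjectiveLiteral Atom)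
  conclusions = map head

  -- L ∈ assumptions A means that not L is an assumption of A.
  assumptions : List (Rule Atom) → List (ObjectiveLiteral Atom)
  assumptions = concatMap default

  IsArgument : Program Atom p → Pred (List (Rule Atom)) (a ⊔ p)
  IsArgument P A =
    All P A ×
    (∀ (i : Fin (length A)) {L} → L ∈ objective (lookup A i) →
       ∃[ k ] i Fin.< k × head (lookup A k) ≡ L)

  ProperSubargument : Program Atom p → Rel (List (Rule Atom)) (a ⊔ p)
  ProperSubargument P B A = B ⊑ A × IsArgument P B × B ≢ A

  MinimalFor : Program Atom p → ObjectiveLiteral Atom → Pred (List (Rule Atom)) (a ⊔ p)
  MinimalFor P L A =
    L ∈ conclusions A ×
    (∀ {B} → ProperSubargument P B A → L ∉ conclusions B)

  IsMinimalArgument : Program Atom p → Pred (List (Rule Atom)) (a ⊔ p)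
  IsMinimalArgument P A = IsArgument P A × ∃[ L ] MinimalFor P L A

  -- Minimality is proof-irrelevant here, so that this is a subset of the
  -- sequences of rules: an argument is determined by its underlying sequence.
  Args : Program Atom p → Set (a ⊔ p)
  Args P = [ A ∈ List (Rule Atom) ∣ IsMinimalArgument P A ]

NotionOfAttack : Set a → (p ℓ : Level) → Set (a ⊔ suc p ⊔ suc ℓ)
NotionOfAttack Atom p ℓ = (P : Program Atom p) → Rel (Args P) ℓ

module _ {Atom : Set a} {p : Level} where

  undercuts rebuts attacks defeats stronglyAttacks stronglyUndercuts : NotionOfAttack Atom p a

  undercuts P A₁ A₂ = ∃[ L ] L ∈ conclusions (value A₁) × L ∈ assumptions (value A₂)

  rebuts P A₁ A₂ = ∃[ L ] L ∈ conclusions (value A₁) × ∼ L ∈ conclusions (value A₂)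

  attacks P = undercuts P ∪ rebuts P

  defeats P = undercuts P ∪ (rebuts P ∖ flip (undercuts P))

  stronglyAttacks P = (undercuts P ∪ rebuts P) ∖ flip (undercuts P)

  stronglyUndercuts P = undercuts P ∖ flip (undercuts P)

module _ {Atom : Set a} {p : Level}
         (x : NotionOfAttack Atom p ℓ₁) (y : NotionOfAttack Atom p ℓ₂)
         (P : Program Atom p) where

  Acceptable : Pred (Args P) s → Pred (Args P) (a ⊔ p ⊔ ℓ₁ ⊔ ℓ₂ ⊔ s)
  Acceptable S A = ∀ B → x P B A → ∃[ C ] S C × y P C B

  -- The least fixpoint of Acceptable, as an inductive predicate;
  -- see justified-fixpoint and justified-least.
  data Justified (A : Args P) : Set (a ⊔ p ⊔ ℓ₁ ⊔ ℓ₂) where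
    justified : Acceptable Justified A → Justified A

module _ {Atom : Set a} {p : Level}
         {x : NotionOfAttack Atom p ℓ₁} {y : NotionOfAttack Atom p ℓ₂}
         {P : Program Atom p} where

  justified-fixpoint : Justified x y P ≐ Acceptable x y P (Justified x y P)
  justified-fixpoint = (λ where (justified acc) → acc) , justified

  justified-least : {S : Pred (Args P) s} → Acceptable x y P S ⊆ S → Justified x y P ⊆ S
  justified-least closed (justified acc) = closed λ B BxA →
    let C , C∈J , CyB = acc B BxA in C , justified-least closed C∈J , CyB

JDung : {Atom : Set a} (P : Program Atom p) → Pred (Args P) (a ⊔ p)
JDung = Justified attacks undercuts

{-# OPTIONS --safe #-}
-- Since su ⊆ u ⊆ d ⊆ a and su ⊆ sa ⊆ a, and justifiability is monotone in the
-- defence, it suffices to show that a/a-justified arguments are a/su-justified.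
-- Suppose that a justified C attacks B, but does not strongly undercut it.  Then
-- B attacks C, because either B undercuts C or C rebuts B, and rebutting is
-- symmetric.  Hence some argument justified at an earlier stage than C attacks B.
-- By well-foundedness this descent ends in a justified strong undercutter of B.
module Submission where

open import Defs
open import Data.List.Membership.Propositional using (_∈_; find; lose)
open import Data.List.Relation.Unary.Any using (any?)
open import Data.Product using (∃-syntax; _×_; _,_; proj₁)
open import Data.Refinement using (value)
open import Data.Sum using (_⊎_; inj₁; inj₂)
open import Function using (id; _∘_)
open import Level using (Level)
open import Relation.Binary using (Decidable; DecidableEquality; _⇒_; Symmetric)
open import Relation.Binary.PropositionalEquality using (_≡_; refl; sym; subst; cong)
open import Relation.Nullary using (yes; no)
open import Relation.Nullary.Decidable using (map′)
open import Relation.Unary using (_⊆_; _≐_)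
import Data.List.Membership.DecPropositional as DecMembership

private
  variable
    a p ℓ₁ ℓ₂ ℓ₃ ℓ₄ : Level
    Atom : Set a

∼-involutive : (L : ObjectiveLiteral Atom) → ∼ ∼ L ≡ L
∼-involutive (pos _) = refl
∼-involutive (neg _) = refl

pos-injective : {B C : Atom} → pos B ≡ pos C → B ≡ C
pos-injective refl = refl

neg-injective : {B C : Atom} → neg B ≡ neg C → B ≡ C
neg-injective refl = refl

literal-≟ : DecidableEquality Atom → DecidableEquality (ObjectiveLiteral Atom)
literal-≟ _≟_ (pos B) (pos C) = map′ (cong pos) pos-injective (B ≟ C)
literal-≟ _≟_ (pos B) (neg C) = no λ ()
literal-≟ _≟_ (neg B) (pos C) = no λ ()
literal-≟ _≟_ (neg B) (neg C) = map′ (cong neg) neg-injective (B ≟ C)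

module _ {Atom : Set a} (P : Program Atom p) where

  rebuts-sym : Symmetric (rebuts P)
  rebuts-sym {A} (L , L∈A , ∼L∈B) =
    ∼ L , ∼L∈B , subst (_∈ conclusions (value A)) (sym (∼-involutive L)) L∈A

  undercuts? : DecidableEquality Atom → Decidable (undercuts P)
  undercuts? _≟_ A B =
    map′ find (λ (L , L∈A , L∈B) → lose L∈A L∈B)
      (any? (_∈? assumptions (value B)) (conclusions (value A)))
    where open DecMembership (literal-≟ _≟_) using (_∈?_)

  attacks⇒stronglyUndercuts⊎attacked :
    DecidableEquality Atom → ∀ {C B} → attacks P C B →
    stronglyUndercuts P C B ⊎ attacks P B C
  -- Deciding whether `B` undercuts `C` back takes the place of excluded middle; this is where
  -- decidable equality of atoms enters.
  attacks⇒stronglyUndercuts⊎attacked _≟_ {C} {B} (inj₁ CuB) with undercuts? _≟_ B C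
  ... | yes BuC = inj₂ (inj₁ BuC)
  ... | no ¬BuC = inj₁ (CuB , ¬BuC)
  attacks⇒stronglyUndercuts⊎attacked _≟_ {C} {B} (inj₂ CrB) =
    inj₂ (inj₂ (rebuts-sym {C} {B} CrB))

  defeats⇒attacks : defeats P ⇒ attacks P
  defeats⇒attacks (inj₁ AuB)       = inj₁ AuB
  defeats⇒attacks (inj₂ (ArB , _)) = inj₂ ArB

  stronglyUndercuts⇒stronglyAttacks : stronglyUndercuts P ⇒ stronglyAttacks P
  stronglyUndercuts⇒stronglyAttacks (AuB , ¬BuA) = inj₁ AuB , ¬BuA

module _ {Atom : Set a} {P : Program Atom p} where

  -- Shrinking `x` leaves fewer attackers to answer, and enlarging `y` keeps every old answer valid.
  justified-mono :
    {x : NotionOfAttack Atom p ℓ₁} {y : NotionOfAttack Atom p ℓ₂}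
    {x′ : NotionOfAttack Atom p ℓ₃} {y′ : NotionOfAttack Atom p ℓ₄} →
    x′ P ⇒ x P → y P ⇒ y′ P → Justified x y P ⊆ Justified x′ y′ P
  justified-mono x′⇒x y⇒y′ = justified-least λ acc → justified λ B Bx′A →
    let C , C∈J , CyB = acc B (x′⇒x Bx′A) in C , C∈J , y⇒y′ CyB

  module _ {x : NotionOfAttack Atom p ℓ₁} {y : NotionOfAttack Atom p ℓ₂}
           {z : NotionOfAttack Atom p ℓ₃}
           (strengthen : ∀ {C B} → y P C B → z P C B ⊎ x P B C) where

    mutual
      justified-strengthen : Justified x y P ⊆ Justified x z P
      justified-strengthen (justified acc) = justified λ B BxA →
        let C , C∈J , CyB = acc B BxA in defender C∈J CyB

      -- The attacker `B` stays fixed while its opponent varies. The mutual recursion is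
      -- well-founded: `justified-strengthen` passes on a smaller justification, and `defender`
      -- hands its own back unchanged at most once before that.
      defender : ∀ {C B} → Justified x y P C → y P C B →
                 ∃[ D ] Justified x z P D × z P D B
      defender {C} C∈J CyB with strengthen CyB
      ... | inj₁ CzB = C , justified-strengthen C∈J , CzB
      -- As `B` attacks `C`, the justification of `C` must itself contain an answer `D` to `B`,
      -- justified by a subderivation.
      defender {B = B} (justified acc) CyB | inj₂ BxC =
        let D , D∈J , DyB = acc B BxC in defender D∈J DyB

-- Some bounds on `x` and `y` are essential to the last inclusion: for `x` total and `y` empty
-- nothing is justified, whereas a single fact is Dung-justified.
corollary8 : ∀ {a p ℓ₁ ℓ₂ : Level} {Atom : Set a} → DecidableEquality Atom →
    (P : Program Atom p) →
    (JDung P ≐ Justified attacks stronglyUndercuts P) ×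
    (Justified attacks stronglyUndercuts P ≐ Justified attacks undercuts P) ×
    (Justified attacks undercuts P ≐ Justified attacks attacks P) ×
    (Justified attacks attacks P ≐ Justified attacks defeats P) ×
    (Justified attacks defeats P ≐ Justified attacks stronglyAttacks P) ×
    ((x : NotionOfAttack Atom p ℓ₁) (y : NotionOfAttack Atom p ℓ₂) →
    x P ⇒ attacks P → stronglyUndercuts P ⇒ y P →
    JDung P ⊆ Justified x y P)
corollary8 _≟_ P =
  (u⊆su , su⊆u) , (su⊆u , u⊆su) ,
  (u⊆a , su⊆u ∘ a⊆su) ,
  (su⊆d ∘ a⊆su , d⊆a) ,
  -- A defeat may be an undercut that is returned, hence no strong attack; the way from `d` to `sa`
  -- therefore leads through `su`.
  (su⊆sa ∘ a⊆su ∘ d⊆a , su⊆d ∘ a⊆su ∘ sa⊆a) ,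
  -- Monotonicity starts from `su` rather than `u`, since `y` is only known to contain `su`.
  λ x y x⇒a su⇒y → justified-mono x⇒a su⇒y ∘ u⊆su
  where
  a⊆su : Justified attacks attacks P ⊆ Justified attacks stronglyUndercuts P
  a⊆su = justified-strengthen λ {C} {B} →
    attacks⇒stronglyUndercuts⊎attacked P _≟_ {C} {B}

  su⊆u : Justified attacks stronglyUndercuts P ⊆ Justified attacks undercuts P
  su⊆u = justified-mono id proj₁

  u⊆a : Justified attacks undercuts P ⊆ Justified attacks attacks P
  u⊆a = justified-mono id inj₁

  u⊆su : Justified attacks undercuts P ⊆ Justified attacks stronglyUndercuts P
  u⊆su = a⊆su ∘ u⊆a

  d⊆a : Justified attacks defeats P ⊆ Justified attacks attacks P
  d⊆a = justified-mono id (λ {A} {B} → defeats⇒attacks P {A} {B})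

  su⊆d : Justified attacks stronglyUndercuts P ⊆ Justified attacks defeats P
  su⊆d = justified-mono id (inj₁ ∘ proj₁)

  sa⊆a : Justified attacks stronglyAttacks P ⊆ Justified attacks attacks P
  sa⊆a = justified-mono id proj₁

  su⊆sa : Justified attacks stronglyUndercuts P ⊆ Justified attacks stronglyAttacks P
  su⊆sa = justified-mono id
    (λ {A} {B} → stronglyUndercuts⇒stronglyAttacks P {A} {B})
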